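{- The graph $L_{8,2}$ has a perfect partition; that is, the set of all $8\times 8$ permutation matrices $P$ with $P\le A(L_{8,2})$ entrywise can be partitioned into subsets each of which sums to $A(L_{8,2})$ (each such subset necessarily has $6$ elements).
   Context: $L_{8,2}=K_{8,8}-4K_{2,2}$; its biadjacency matrix $A(L_{8,2})$ is the $8\times 8$ matrix which, written in $2\times 2$ block form $(A_{ij})_{1\le i,j\le 4}$, has $A_{ii}=O_2$ (zero matrix) and $A_{ij}=J_2$ (all-ones) for $i\ne j$. A regular bipartite graph $G$ has a perfect partition if its set of perfect matchings can be partitioned into parts each of which is a $1$-factorization of $G$; in matrix language, the set of permutation matrices $P\le A(G)$ can be partitioned into subsets each summing to $A(G)$. -}

module Defs where

open import Data.Bool.Base using (if_then_else_)
open import Data.Fin.Base using (Fin; quotient; remainder)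
open import Data.Fin.Permutation using (Permutation′; _⟨$⟩ʳ_)
open import Data.Fin.Properties using (_≟_)
open import Data.Fin.Subset using (Subset; ∣_∣; _─_) renaming (⊤ to full; _∈_ to _∈ₛ_)
open import Data.List.Base using (List; foldr)
open import Data.List.Membership.Propositional using (_∈_)
open import Data.List.Relation.Unary.All using (All)
open import Data.List.Relation.Unary.AllPairs using (AllPairs)
open import Data.List.Relation.Unary.Any using (Any)
open import Data.List.Relation.Unary.Unique.Propositional using (Unique)
open import Data.Nat.Base using (ℕ; _+_; _*_; _≤_)
open import Data.Product using (∃; ∃!; _×_; _,_)
open import Data.Vec.Base using (Vec; lookup; map; replicate; tabulate; zipWith)
open import Function.Bundles using (_⇔_)
open import Relation.Binary.PropositionalEquality using (_≡_; refl)
open import Relation.Nullary using (¬_; does)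

-- The members of a finite family of "subsets" of A are codes X : B, whose
-- elements are given by the relation _∋_.
record IsPartition {A B : Set} (_∋_ : B → A → Set) (S : A → Set)
                   (parts : List B) : Set where
  field
    nonempty : All (λ X → ∃ λ a → X ∋ a) parts
    disjoint : AllPairs (λ X Y → ∀ a → ¬ (X ∋ a × Y ∋ a)) parts
    union    : ∀ a → S a ⇔ Any (λ X → X ∋ a) parts

-- Partition into finite subsets, each coded by a repetition-free list.
record IsListPartition {A : Set} (S : A → Set) (parts : List (List A)) : Set where
  field
    unique      : All Unique parts
    isPartition : IsPartition (λ X a → a ∈ X) S parts

-- A set of edges of K_{n,n}, i.e. a bipartite graph with n + n vertices:
-- row u is the set of right vertices joined to the left vertex u.
EdgeSet : ℕ → Set
EdgeSet n = Vec (Subset n) n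

Edge : ℕ → Set
Edge n = Fin n × Fin n

_∋ₑ_ : ∀ {n} → EdgeSet n → Edge n → Set
E ∋ₑ (u , v) = v ∈ₛ lookup E u

_⊆ₑ_ : ∀ {n} → EdgeSet n → EdgeSet n → Set
E ⊆ₑ F = ∀ e → E ∋ₑ e → F ∋ₑ e

leftDegree : ∀ {n} → EdgeSet n → Fin n → ℕ
leftDegree G u = ∣ lookup G u ∣

rightDegree : ∀ {n} → EdgeSet n → Fin n → ℕ
rightDegree G v = ∣ map (λ r → lookup r v) G ∣

IsRegular : ∀ {n} → ℕ → EdgeSet n → Set
IsRegular d G = (∀ u → leftDegree G u ≡ d) × (∀ v → rightDegree G v ≡ d)

record IsPerfectMatching {n : ℕ} (G M : EdgeSet n) : Set where
  field
    subgraph : M ⊆ₑ G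
    left     : ∀ u → ∃! _≡_ λ v → M ∋ₑ (u , v)
    right    : ∀ v → ∃! _≡_ λ u → M ∋ₑ (u , v)

record IsOneFactorization {n : ℕ} (G : EdgeSet n) (Ms : List (EdgeSet n)) : Set where
  field
    perfect     : All (IsPerfectMatching G) Ms
    isPartition : IsPartition _∋ₑ_ (G ∋ₑ_) Ms

record HasPerfectPartition {n : ℕ} (G : EdgeSet n) : Set where
  field
    regular        : ∃ λ d → IsRegular d G
    parts          : List (List (EdgeSet n))
    isPartition    : IsListPartition (IsPerfectMatching G) parts
    factorizations : All (IsOneFactorization G) parts

Matrix : ℕ → Set
Matrix n = Vec (Vec ℕ n) n

entry : ∀ {n} → Matrix n → Fin n → Fin n → ℕ
entry A i j = lookup (lookup A i) j

_≤ₘ_ : ∀ {n} → Matrix n → Matrix n → Set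
A ≤ₘ B = ∀ i j → entry A i j ≤ entry B i j

_+ₘ_ : ∀ {n} → Matrix n → Matrix n → Matrix n
_+ₘ_ = zipWith (zipWith _+_)

constMatrix : ∀ {n} → ℕ → Matrix n
constMatrix c = replicate _ (replicate _ c)

sumₘ : ∀ {n} → List (Matrix n) → Matrix n
sumₘ = foldr _+ₘ_ (constMatrix 0)

permutationMatrix : ∀ {n} → Permutation′ n → Matrix n
permutationMatrix σ = tabulate λ i → tabulate λ j → if does (σ ⟨$⟩ʳ i ≟ j) then 1 else 0

IsPermutationMatrix : ∀ {n} → Matrix n → Set
IsPermutationMatrix {n} P = ∃ λ (σ : Permutation′ n) → P ≡ permutationMatrix σ

IsPermutationMatrixBelow : ∀ {n} → Matrix n → Matrix n → Set
IsPermutationMatrixBelow A P = IsPermutationMatrix P × P ≤ₘ A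

record HasMatrixPerfectPartition {n : ℕ} (A : Matrix n) : Set where
  field
    parts       : List (List (Matrix n))
    isPartition : IsListPartition (IsPermutationMatrixBelow A) parts
    sums        : All (λ Ps → sumₘ Ps ≡ A) parts

biadjacency : ∀ {n} → EdgeSet n → Matrix n
biadjacency = map (map (λ b → if b then 1 else 0))

completeBipartite : ∀ n → EdgeSet n
completeBipartite n = replicate n full

-- m K_{k,k}, with vertex (block q, position r) numbered q * k + r on each side.
copies : ∀ m k → EdgeSet (m * k)
copies m k = tabulate λ u → tabulate λ v → does (quotient {m} k u ≟ quotient {m} k v)

_∖_ : ∀ {n} → EdgeSet n → EdgeSet n → EdgeSet n
_∖_ = zipWith _─_

L₈₂ : EdgeSet 8
L₈₂ = completeBipartite 8 ∖ copies 4 2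

blockMatrix : ∀ {m k} → (Fin m → Fin m → Matrix k) → Matrix (m * k)
blockMatrix {m} {k} B = tabulate λ i → tabulate λ j →
  entry (B (quotient {m} k i) (quotient {m} k j)) (remainder {m} k i) (remainder {m} k j)

biadjacency-L₈₂ : biadjacency L₈₂ ≡
  blockMatrix {4} {2} (λ i j → if does (i ≟ j) then constMatrix 0 else constMatrix 1)
biadjacency-L₈₂ = refl

{-# OPTIONS --safe #-}
module Submission where

-- Send a perfect matching of L₈₂ to its word: the letter in row u is the block
-- of the column matched with u. Exchanging the two columns of a block keeps the
-- word, and each word comes from 2⁴ matchings, one for each choice of signs.
-- If three words have, in every row u, the three letters other than the block
-- of u, then the three matchings with these words and given signs, together with
-- the matchings obtained from them by exchanging the columns in all the blocks,
-- form a 1-factorization. Hence a partition of the 297 words into 99 such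
-- triples yields a partition of the 4752 matchings into 99 · 2³ 1-factorizations.

open import Defs
open import Data.Bool.Base using (Bool; true; false; not; _xor_; if_then_else_)
import Data.Bool.Properties as Bool
open import Data.Fin.Base using (Fin; zero; suc; quotient; remainder; combine)
open import Data.Fin.Permutation using (Permutation′; permutation; _⟨$⟩ʳ_; _⟨$⟩ˡ_; inverseˡ)
open import Data.Fin.Properties using (_≟_; all?; any?; punchOut-injective; injective⇒≤)
open import Data.Fin.Subset using (⁅_⁆) renaming (_∈_ to _∈ₛ_)
open import Data.Fin.Subset.Properties using (x∈⁅x⁆; x∈⁅y⁆⇒x≡y; ⊆-antisym) renaming (_∈?_ to _∈ₛ?_)
open import Data.List.Base using (List; []; _∷_; allFin; cartesianProductWith; concatMap; filter; length; map)
open import Data.List.Membership.Propositional using (_∈_; _∉_; find; lose)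
open import Data.List.Membership.Propositional.Properties using (∈-map⁺; ∈-map⁻; ∈-cartesianProductWith⁺; ∈-cartesianProductWith⁻; ∈-filter⁺; ∈-allFin)
open import Data.List.Relation.Unary.All as All using (All; []; _∷_)
import Data.List.Relation.Unary.All.Properties as All
open import Data.List.Relation.Unary.AllPairs as AllPairs using (AllPairs; []; _∷_)
import Data.List.Relation.Unary.AllPairs.Properties as AllPairs
open import Data.List.Relation.Unary.Any as Any using (Any; here; there)
import Data.List.Relation.Unary.Any.Properties as Any
open import Data.List.Relation.Unary.Unique.Propositional using (Unique)
import Data.List.Relation.Unary.Unique.Propositional.Properties as Unique
open import Data.Nat.Base using (ℕ; zero; suc; _+_; _≤_; z≤n; s≤s; _/_; _%_)
open import Data.Nat.DivMod using (_mod_)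
import Data.Nat.Properties as ℕ
open import Data.Product using (∃; _×_; _,_; proj₁; proj₂)
import Data.Product.Properties as Product
open import Algebra.Properties.CommutativeSemigroup ℕ.+-commutativeSemigroup using (interchange)
open import Data.Vec.Base as Vec using (Vec; []; _∷_; lookup; tabulate; updateAt; count)
open import Data.Vec.Properties using (lookup-map; lookup-replicate; lookup-zipWith; lookup∘tabulate; tabulate∘lookup; tabulate-cong; lookup⇒[]=; []=⇒lookup; ≡-dec; ∷-injective; map-∘; map-cong; map-id; updateAt-commutes; updateAt-id-local; updateAt-updateAt; lookup∘updateAt; lookup∘updateAt′)
import Data.Vec.Relation.Unary.All as VecAll
import Data.Vec.Relation.Unary.AllPairs as VecAllPairs
import Data.Vec.Relation.Unary.Unique.Propositional as VecUnique
import Data.Vec.Relation.Unary.Unique.Propositional.Properties as VecUnique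
open import Function.Base using (_∘_; id)
open import Function.Bundles using (_⇔_; mk⇔; Equivalence)
open import Function.Definitions using (Injective)
open import Relation.Binary.PropositionalEquality using (_≡_; _≢_; _≗_; refl; sym; trans; cong; cong₂; subst; module ≡-Reasoning)
open import Relation.Nullary using (¬_; Dec; yes; no; does; contradiction)
open import Relation.Nullary.Decidable using (True; toWitness; ¬?; _×-dec_; _→-dec_; dec-true; map′)

-- Finite injections and transport of partitions

lookup-extensional : ∀ {A : Set} {n} {xs ys : Vec A n} → lookup xs ≗ lookup ys → xs ≡ ys
lookup-extensional {xs = xs} {ys} eq =
  trans (sym (tabulate∘lookup xs)) (trans (tabulate-cong eq) (tabulate∘lookup ys))

-- Pigeonhole: if `v` were missed, punching it out of the codomain would leave an injection from
-- `Fin (suc n)` into `Fin n`.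
injective⇒surjective : ∀ {n} {f : Fin n → Fin n} → Injective _≡_ _≡_ f → ∀ v → ∃ λ u → f u ≡ v
injective⇒surjective {suc n} {f} inj v with any? (λ u → f u ≟ v)
... | yes hit = hit
... | no miss = contradiction
  (injective⇒≤ (λ {i} {j} eq → inj (punchOut-injective (v≢f i) (v≢f j) eq))) ℕ.1+n≰n
  where
  v≢f : ∀ u → v ≢ f u
  v≢f u v≡fu = miss (u , sym v≡fu)

private
  variable
    n : ℕ
    A B : Set

map-injective : {f : A → B} → Injective _≡_ _≡_ f → Injective _≡_ _≡_ (Vec.map {n = n} f)
map-injective inj {[]}    {[]}    _  = refl
map-injective inj {_ ∷ _} {_ ∷ _} eq =
  cong₂ _∷_ (inj (proj₁ (∷-injective eq))) (map-injective inj (proj₂ (∷-injective eq)))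

-- The partition is built once, for vectors; this lemma carries it over both to edge sets and to
-- matrices, along injective encodings.
IsListPartition-map : {S : A → Set} {T : B → Set} {parts : List (List A)} (f : A → B) →
  Injective _≡_ _≡_ f → (∀ b → T b ⇔ ∃ λ a → S a × b ≡ f a) →
  IsListPartition S parts → IsListPartition T (map (map f) parts)
IsListPartition-map {S = S} {T} {parts} f inj T⇔ P = record
  { unique      = All.map⁺ (All.map (Unique.map⁺ inj) unique)
  ; isPartition = record
    { nonempty = All.map⁺ (All.map (λ (a , a∈X) → f a , ∈-map⁺ f a∈X) nonempty)
    ; disjoint = AllPairs.map⁺ (AllPairs.map apart disjoint)
    ; union    = λ b → mk⇔ (to b) (from b)
    }
  }
  where
  open IsListPartition P
  open IsPartition isPartition
  apart : ∀ {X Y} → (∀ a → ¬ (a ∈ X × a ∈ Y)) → ∀ b → ¬ (b ∈ map f X × b ∈ map f Y)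
  apart X#Y b (b∈X , b∈Y) with ∈-map⁻ f b∈X | ∈-map⁻ f b∈Y
  ... | a , a∈X , refl | a′ , a′∈Y , eq = X#Y a (a∈X , subst (_∈ _) (sym (inj eq)) a′∈Y)
  to : ∀ b → T b → Any (b ∈_) (map (map f) parts)
  to b Tb with Equivalence.to (T⇔ b) Tb
  ... | a , Sa , refl = Any.map⁺ (Any.map (∈-map⁺ f) (Equivalence.to (union a) Sa))
  from : ∀ b → Any (b ∈_) (map (map f) parts) → T b
  from b b∈ with find (Any.map⁻ b∈)
  ... | X , X∈parts , b∈X with ∈-map⁻ f b∈X
  ... | a , a∈X , b≡fa = Equivalence.from (T⇔ b)
    (a , Equivalence.from (union a) (lose X∈parts a∈X) , b≡fa)

-- Perfect matchings and permutation matrices as vectors of right vertices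

record IsMatchingVec {n} (G : EdgeSet n) (p : Vec (Fin n) n) : Set where
  constructor _,_
  field
    edges  : ∀ u → G ∋ₑ (u , lookup p u)
    unique : VecUnique.Unique p

toEdges : Vec (Fin n) n → EdgeSet n
toEdges = Vec.map ⁅_⁆

∈-toEdges⁻ : ∀ (p : Vec (Fin n) n) {u v} → toEdges p ∋ₑ (u , v) → v ≡ lookup p u
∈-toEdges⁻ p {u} {v} v∈ = x∈⁅y⁆⇒x≡y _ (subst (v ∈ₛ_) (lookup-map u ⁅_⁆ p) v∈)

∈-toEdges⁺ : ∀ (p : Vec (Fin n) n) u → toEdges p ∋ₑ (u , lookup p u)
∈-toEdges⁺ p u = subst (lookup p u ∈ₛ_) (sym (lookup-map u ⁅_⁆ p)) (x∈⁅x⁆ _)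

toEdges-injective : Injective _≡_ _≡_ (toEdges {n})
toEdges-injective {x = p} {y = q} eq = lookup-extensional λ u →
  ∈-toEdges⁻ q (subst (λ E → E ∋ₑ (u , lookup p u)) eq (∈-toEdges⁺ p u))

-- The condition on left vertices makes `M` the graph of a function, and the one on right vertices
-- makes this function injective. Conversely, an injective self-map of `Fin n` is onto, which
-- supplies the partner of each right vertex.
IsPerfectMatching⇔ : (G M : EdgeSet n) →
  IsPerfectMatching G M ⇔ ∃ λ p → IsMatchingVec G p × M ≡ toEdges p
IsPerfectMatching⇔ {n} G M = mk⇔ to (λ { (p , p✓ , refl) → from p p✓ })
  where
  to : IsPerfectMatching G M → ∃ λ p → IsMatchingVec G p × M ≡ toEdges p
  to M✓ = tabulate f , (edges , VecUnique.tabulate⁺ f-injective) , lookup-extensional rows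
    where
    open IsPerfectMatching M✓
    f : Fin n → Fin n
    f u = proj₁ (left u)
    f∈M : ∀ u → M ∋ₑ (u , f u)
    f∈M u = proj₁ (proj₂ (left u))
    edges : ∀ u → G ∋ₑ (u , lookup (tabulate f) u)
    edges u rewrite lookup∘tabulate f u = subgraph (u , f u) (f∈M u)
    f-injective : ∀ {u u′} → f u ≡ f u′ → u ≡ u′
    f-injective {u} {u′} eq = let _ , _ , only = right (f u) in
      trans (sym (only (f∈M u))) (only (subst (λ v → M ∋ₑ (u′ , v)) (sym eq) (f∈M u′)))
    rows : ∀ u → lookup M u ≡ lookup (toEdges (tabulate f)) u
    rows u rewrite lookup-map u ⁅_⁆ (tabulate f) | lookup∘tabulate f u = ⊆-antisym
      (λ {v} v∈ → subst (λ w → v ∈ₛ ⁅ w ⁆) (sym (proj₂ (proj₂ (left u)) v∈)) (x∈⁅x⁆ v))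
      (λ v∈ → subst (_∈ₛ lookup M u) (sym (x∈⁅y⁆⇒x≡y _ v∈)) (f∈M u))

  from : ∀ p → IsMatchingVec G p → IsPerfectMatching G (toEdges p)
  from p (edges , unique) = record
    { subgraph = λ (u , v) v∈ → subst (λ v → G ∋ₑ (u , v)) (sym (∈-toEdges⁻ p v∈)) (edges u)
    ; left     = λ u → lookup p u , ∈-toEdges⁺ p u , sym ∘ ∈-toEdges⁻ p
    ; right    = right
    }
    where
    inj : Injective _≡_ _≡_ (lookup p)
    inj = VecUnique.lookup-injective unique _ _
    right : ∀ v → _
    right v with injective⇒surjective inj v
    ... | u , refl = u , ∈-toEdges⁺ p u , inj ∘ ∈-toEdges⁻ p

toMatrix : Vec (Fin n) n → Matrix n
toMatrix p = tabulate λ i → tabulate λ j → if does (lookup p i ≟ j) then 1 else 0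

entry-tabulate : ∀ (f : Fin n → Fin n → ℕ) i j → entry (tabulate λ i → tabulate (f i)) i j ≡ f i j
entry-tabulate f i j =
  trans (cong (λ r → lookup r j) (lookup∘tabulate (λ i → tabulate (f i)) i)) (lookup∘tabulate (f i) j)

entry-toMatrix : ∀ (p : Vec (Fin n) n) i j → entry (toMatrix p) i j ≡ (if does (lookup p i ≟ j) then 1 else 0)
entry-toMatrix p = entry-tabulate (λ i j → if does (lookup p i ≟ j) then 1 else 0)

entry-toMatrix-lookup : ∀ (p : Vec (Fin n) n) i → entry (toMatrix p) i (lookup p i) ≡ 1
entry-toMatrix-lookup p i rewrite entry-toMatrix p i (lookup p i)
  | dec-true (lookup p i ≟ lookup p i) refl = refl

-- If the vectors differed in row `i`, the entry at column `lookup p i` would be 1 in one matrix and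
-- 0 in the other.
toMatrix-injective : Injective _≡_ _≡_ (toMatrix {n})
toMatrix-injective {x = p} {y = q} eq = lookup-extensional agree
  where
  agree : ∀ i → lookup p i ≡ lookup q i
  agree i with lookup q i ≟ lookup p i | entry-toMatrix q i (lookup p i)
  ... | yes eq′ | _ = sym eq′
  ... | no _    | entry≡0 = contradiction
    (trans (sym (entry-toMatrix-lookup p i)) (trans (cong (λ A → entry A i (lookup p i)) eq) entry≡0))
    λ ()

entry-biadjacency : ∀ (G : EdgeSet n) i j →
  entry (biadjacency G) i j ≡ (if lookup (lookup G i) j then 1 else 0)
entry-biadjacency G i j =
  trans (cong (λ r → lookup r j) (lookup-map i _ G)) (lookup-map j _ (lookup G i))

toMatrix≤⇔ : ∀ (G : EdgeSet n) p → toMatrix p ≤ₘ biadjacency G ⇔ (∀ u → G ∋ₑ (u , lookup p u))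
toMatrix≤⇔ {n} G p = mk⇔ to from
  where
  to : toMatrix p ≤ₘ biadjacency G → ∀ u → G ∋ₑ (u , lookup p u)
  to p≤G u = lookup⇒[]= _ _ (present (lookup (lookup G u) (lookup p u)) 1≤)
    where
    1≤ : 1 ≤ (if lookup (lookup G u) (lookup p u) then 1 else 0)
    1≤ = subst (1 ≤_) (entry-biadjacency G u _)
           (subst (_≤ entry (biadjacency G) u (lookup p u)) (entry-toMatrix-lookup p u) (p≤G u (lookup p u)))
    present : ∀ b → 1 ≤ (if b then 1 else 0) → b ≡ true
    present true _ = refl
  from : (∀ u → G ∋ₑ (u , lookup p u)) → toMatrix p ≤ₘ biadjacency G
  from edges i j rewrite entry-toMatrix p i j | entry-biadjacency G i j with lookup p i ≟ j
  ... | no _     = z≤n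
  ... | yes refl rewrite []=⇒lookup (edges i) = ℕ.≤-refl

IsPermutationMatrixBelow⇔ : (G : EdgeSet n) (P : Matrix n) →
  IsPermutationMatrixBelow (biadjacency G) P ⇔ ∃ λ p → IsMatchingVec G p × P ≡ toMatrix p
IsPermutationMatrixBelow⇔ {n} G P =
  mk⇔ (λ { ((σ , refl) , σ≤G) → to σ σ≤G }) (λ { (p , p✓ , refl) → from p p✓ })
  where
  to : ∀ σ → permutationMatrix σ ≤ₘ biadjacency G →
       ∃ λ p → IsMatchingVec G p × permutationMatrix σ ≡ toMatrix p
  to σ σ≤G = p , (Equivalence.to (toMatrix≤⇔ G p) (subst (_≤ₘ biadjacency G) σ≡p σ≤G)
                 , VecUnique.tabulate⁺ σ-injective) , σ≡p
    where
    p = tabulate (σ ⟨$⟩ʳ_)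
    σ≡p : permutationMatrix σ ≡ toMatrix p
    σ≡p = tabulate-cong λ i → tabulate-cong λ j →
      cong (λ v → if does (v ≟ j) then 1 else 0) (sym (lookup∘tabulate (σ ⟨$⟩ʳ_) i))
    σ-injective : ∀ {i j} → σ ⟨$⟩ʳ i ≡ σ ⟨$⟩ʳ j → i ≡ j
    σ-injective eq = trans (sym (inverseˡ σ)) (trans (cong (σ ⟨$⟩ˡ_) eq) (inverseˡ σ))
  from : ∀ p → IsMatchingVec G p → IsPermutationMatrixBelow (biadjacency G) (toMatrix p)
  from p (edges , unique) = (σ , refl) , Equivalence.from (toMatrix≤⇔ G p) edges
    where
    inj : Injective _≡_ _≡_ (lookup p)
    inj = VecUnique.lookup-injective unique _ _
    surj = injective⇒surjective inj
    σ : Permutation′ n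
    -- The inverse is a choice of preimages, which exist by finiteness.
    σ = permutation (lookup p) (proj₁ ∘ surj) (proj₂ ∘ surj) (λ i → inj (proj₂ (surj (lookup p i))))

-- 1-factorizations as lists of vectors

at : Fin n → List (Vec (Fin n) n) → List (Fin n)
at u = map (λ p → lookup p u)

-- A decidable criterion, row by row: the partners of `u` are distinct and exhaust its neighbours.
-- That they are neighbours comes from `IsMatchingVec`.
IsFactorizationVec : EdgeSet n → List (Vec (Fin n) n) → Set
IsFactorizationVec G ps = ∀ u → Unique (at u ps) × (∀ v → G ∋ₑ (u , v) → v ∈ at u ps)

IsFactorizationVec⇒Unique : ∀ {G : EdgeSet (suc n)} {ps} → IsFactorizationVec G ps → Unique ps
IsFactorizationVec⇒Unique F =
  AllPairs.map (λ ≢ eq → ≢ (cong (λ p → lookup p zero) eq)) (AllPairs.map⁻ (proj₁ (F zero)))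

-- An edge (u , v) common to two matchings would make `v` appear twice among the partners of `u`. A
-- left vertex `zero` exists, so every matching has an edge.
IsFactorizationVec⇒IsOneFactorization : ∀ {G : EdgeSet (suc n)} {ps} → All (IsMatchingVec G) ps →
  IsFactorizationVec G ps → IsOneFactorization G (map toEdges ps)
IsFactorizationVec⇒IsOneFactorization {G = G} {ps} ps✓ F = record
  { perfect     = All.map⁺ (All.map (λ p✓ → Equivalence.from (IsPerfectMatching⇔ G _) (_ , p✓ , refl)) ps✓)
  ; isPartition = record
    { nonempty = All.map⁺ (All.universal (λ p → (zero , lookup p zero) , ∈-toEdges⁺ p zero) ps)
    ; disjoint = AllPairs.map⁺ (allPairs λ (u , v) → AllPairs.map (λ {p} {q} → apart u v p q) (AllPairs.map⁻ (proj₁ (F u))))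
    ; union    = λ (u , v) → mk⇔ (to u v) (from u v)
    }
  }
  where
  -- Distinctness is known for one row at a time; this moves the quantifier over edges inside
  -- `AllPairs`.
  allPairs : ∀ {E : Set} {R : E → A → A → Set} {xs} →
    (∀ e → AllPairs (R e) xs) → AllPairs (λ x y → ∀ e → R e x y) xs
  allPairs {xs = []}     _ = []
  allPairs {xs = x ∷ xs} r =
    All.tabulate (λ y∈ e → All.lookup (AllPairs.head (r e)) y∈) ∷ allPairs (AllPairs.tail ∘ r)
  apart : ∀ u v (p q : Vec (Fin _) _) → lookup p u ≢ lookup q u →
    ¬ (toEdges p ∋ₑ (u , v) × toEdges q ∋ₑ (u , v))
  apart u v p q ≢ (v∈p , v∈q) = ≢ (trans (sym (∈-toEdges⁻ p v∈p)) (∈-toEdges⁻ q v∈q))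
  to : ∀ u v → G ∋ₑ (u , v) → Any (_∋ₑ (u , v)) (map toEdges ps)
  to u v v∈ = Any.map⁺ (Any.map (λ {p} v≡ → subst (λ w → toEdges p ∋ₑ (u , w)) (sym v≡) (∈-toEdges⁺ p u))
    (Any.map⁻ (proj₂ (F u) v v∈)))
  from : ∀ u v → Any (_∋ₑ (u , v)) (map toEdges ps) → G ∋ₑ (u , v)
  from u v v∈ with find (Any.map⁻ v∈)
  ... | p , p∈ , v∈p = subst (λ w → G ∋ₑ (u , w)) (sym (∈-toEdges⁻ p v∈p))
    (IsMatchingVec.edges (All.lookup ps✓ p∈) u)

entry-+ₘ : ∀ (M N : Matrix n) i j → entry (M +ₘ N) i j ≡ entry M i j + entry N i j
entry-+ₘ M N i j = trans (cong (λ r → lookup r j) (lookup-zipWith (Vec.zipWith _+_) i M N))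
  (lookup-zipWith _+_ j (lookup M i) (lookup N i))

entry-constMatrix : ∀ c (i j : Fin n) → entry (constMatrix c) i j ≡ c
entry-constMatrix {n} c i j =
  trans (cong (λ r → lookup r j) (lookup-replicate i (Vec.replicate n c))) (lookup-replicate j c)

entry-sum-∉ : ∀ {u v : Fin n} ps → v ∉ at u ps → entry (sumₘ (map toMatrix ps)) u v ≡ 0
entry-sum-∉ {u = u} {v} []       _  = entry-constMatrix 0 u v
entry-sum-∉ {u = u} {v} (p ∷ ps) v∉
  rewrite entry-+ₘ (toMatrix p) (sumₘ (map toMatrix ps)) u v | entry-toMatrix p u v
  with lookup p u ≟ v
... | yes eq = contradiction (here (sym eq)) v∉
... | no  _  = entry-sum-∉ ps (v∉ ∘ there)

-- The first matching that uses (u , v) contributes 1; by distinctness the later ones contribute 0.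
entry-sum-∈ : ∀ {u v : Fin n} ps → Unique (at u ps) → v ∈ at u ps → entry (sumₘ (map toMatrix ps)) u v ≡ 1
entry-sum-∈ {u = u} {v} (p ∷ ps) (p≢ ∷ unique) v∈
  rewrite entry-+ₘ (toMatrix p) (sumₘ (map toMatrix ps)) u v | entry-toMatrix p u v
  with lookup p u ≟ v | v∈
... | yes eq | _          = cong suc (entry-sum-∉ ps λ v∈ps → All.lookup p≢ v∈ps eq)
... | no ≢v  | here eq    = contradiction (sym eq) ≢v
... | no _   | there v∈ps = entry-sum-∈ ps unique v∈ps

IsFactorizationVec⇒sum : ∀ {G : EdgeSet n} {ps} → All (IsMatchingVec G) ps →
  IsFactorizationVec G ps → sumₘ (map toMatrix ps) ≡ biadjacency G
IsFactorizationVec⇒sum {G = G} {ps} ps✓ F = lookup-extensional λ u → lookup-extensional λ v →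
  trans (entries u v) (sym (entry-biadjacency G u v))
  where
  entries : ∀ u v → entry (sumₘ (map toMatrix ps)) u v ≡ (if lookup (lookup G u) v then 1 else 0)
  entries u v with lookup (lookup G u) v in eq
  ... | true  = entry-sum-∈ ps (proj₁ (F u)) (proj₂ (F u) v (lookup⇒[]= v _ eq))
  ... | false = entry-sum-∉ ps absent
    where
    absent : v ∉ at u ps
    absent v∈ with ∈-map⁻ (λ p → lookup p u) v∈
    ... | p , p∈ , refl = contradiction
      (trans (sym eq) ([]=⇒lookup (IsMatchingVec.edges (All.lookup ps✓ p∈) u))) λ ()

-- Lifting block words to matchings

Word : ℕ → Set
Word = Vec (Fin 4)

Signs : Set
Signs = Vec Bool 4

-- The row u of a word goes to the column (b , β), where b is its letter and
-- the side β alternates over the successive occurrences of b, starting from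
-- the sign of b.
assemble : Word n → Signs → Vec (Fin 4 × Bool) n
assemble []      s = []
assemble (b ∷ w) s = (b , lookup s b) ∷ assemble w (updateAt s b not)

map-proj₁-assemble : ∀ (w : Word n) s → Vec.map proj₁ (assemble w s) ≡ w
map-proj₁-assemble []      s = refl
map-proj₁-assemble (b ∷ w) s = cong (b ∷_) (map-proj₁-assemble w _)

≢⇒≡not : ∀ {β γ} → β ≢ γ → β ≡ not γ
≢⇒≡not {β} {γ} β≢γ with β | γ
... | false | false = contradiction refl β≢γ
... | false | true  = refl
... | true  | false = refl
... | true  | true  = contradiction refl β≢γ

-- If `b` does not occur in `w`, its sign is never read. Otherwise the first occurrence of `b` shows
-- its sign, which differs from `β` and so already is `not β`.
assemble-update : ∀ (w : Word n) s b β → VecAll.All ((b , β) ≢_) (assemble w s) →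
  assemble w (updateAt s b (λ _ → not β)) ≡ assemble w s
assemble-update []      s b β _ = refl
assemble-update (a ∷ w) s b β (≢ VecAll.∷ ≢s) with b ≟ a
... | yes refl = cong (assemble (a ∷ w))
  (updateAt-id-local a s (sym (≢⇒≡not λ eq → ≢ (cong (a ,_) (sym eq)))))
... | no b≢a = cong₂ _∷_ (cong (a ,_) (lookup∘updateAt′ a b (b≢a ∘ sym) s))
  (trans (cong (assemble w) (updateAt-commutes a b (b≢a ∘ sym) s))
         (assemble-update w (updateAt s a not) b β ≢s))

-- Induction from the right: giving `b` the sign `β` produces the head, and the tail is then read
-- with the sign `not β`. This does not alter the tail, as (b , β) is absent from it.
assemble-surjective : ∀ (x : Vec (Fin 4 × Bool) n) → VecUnique.Unique x →
  ∃ λ s → assemble (Vec.map proj₁ x) s ≡ x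
-- Any signs serve for the empty word.
assemble-surjective []            _ = Vec.replicate 4 false , refl
assemble-surjective ((b , β) ∷ x) (x≢ VecAllPairs.∷ unique) with assemble-surjective x unique
... | s , eq = updateAt s b (λ _ → β) , cong₂ _∷_ (cong (b ,_) (lookup∘updateAt b s)) (begin
  assemble w (updateAt (updateAt s b (λ _ → β)) b not)  ≡⟨ cong (assemble w) (updateAt-updateAt b s) ⟩
  assemble w (updateAt s b (λ _ → not β))               ≡⟨ assemble-update w s b β (subst (VecAll.All _) (sym eq) x≢) ⟩
  assemble w s                                          ≡⟨ eq ⟩
  x                                                     ∎)
  where
  open ≡-Reasoning
  w = Vec.map proj₁ x

-- The first occurrence of a letter displays its initial sign; flips of other letters before it
-- leave that sign unchanged.
assemble-injective : ∀ (w : Word n) {s s′} → assemble w s ≡ assemble w s′ →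
  ∀ u → lookup s (lookup w u) ≡ lookup s′ (lookup w u)
assemble-injective (b ∷ w) eq zero = proj₂ (Product.,-injective (proj₁ (∷-injective eq)))
assemble-injective (a ∷ w) {s} {s′} eq (suc u)
  with lookup w u ≟ a | assemble-injective w (proj₂ (∷-injective eq)) u
... | yes refl | _  = proj₂ (Product.,-injective (proj₁ (∷-injective eq)))
... | no b≢a   | ih = trans (sym (lookup∘updateAt′ _ a b≢a s)) (trans ih (lookup∘updateAt′ _ a b≢a s′))

-- Admissible words

occurrences : Fin 4 → Word n → ℕ
occurrences b = count (b ≟_)

module _ {b : Fin 4} where

  -- In this and the next two lemmas the bound is the number of sides of `b` still available: by
  -- distinctness, each occurrence of `b` excludes its own side from the tail.
  occurrences≤0 : ∀ (x : Vec (Fin 4 × Bool) n) {β} → VecAll.All ((b , β) ≢_) x →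
    VecAll.All ((b , not β) ≢_) x → occurrences b (Vec.map proj₁ x) ≤ 0
  occurrences≤0 []      _ _ = z≤n
  occurrences≤0 ((a , γ) ∷ x) (≢₁ VecAll.∷ x≢₁) (≢₂ VecAll.∷ x≢₂) with b ≟ a
  ... | no _     = occurrences≤0 x x≢₁ x≢₂
  ... | yes refl = contradiction (cong (a ,_) (sym (≢⇒≡not (λ eq → ≢₁ (cong (a ,_) (sym eq)))))) ≢₂

  occurrences≤1 : ∀ (x : Vec (Fin 4 × Bool) n) {β} → VecUnique.Unique x →
    VecAll.All ((b , β) ≢_) x → occurrences b (Vec.map proj₁ x) ≤ 1
  occurrences≤1 []      _ _ = z≤n
  occurrences≤1 ((a , γ) ∷ x) (γ∉x VecAllPairs.∷ unique) (≢ VecAll.∷ x≢) with b ≟ a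
  ... | no _     = occurrences≤1 x unique x≢
  ... | yes refl with ≢⇒≡not (λ eq → ≢ (cong (a ,_) (sym eq)))
  ... | refl = s≤s (occurrences≤0 x x≢ γ∉x)

  occurrences≤2 : ∀ (x : Vec (Fin 4 × Bool) n) → VecUnique.Unique x →
    occurrences b (Vec.map proj₁ x) ≤ 2
  occurrences≤2 []      _ = z≤n
  occurrences≤2 ((a , γ) ∷ x) (γ∉x VecAllPairs.∷ unique) with b ≟ a
  ... | no _     = occurrences≤2 x unique
  ... | yes refl = s≤s (occurrences≤1 x unique γ∉x)

side : Bool → Fin 2
side false = zero
side true  = suc zero

column : Fin 4 × Bool → Fin 8
column (b , β) = combine b (side β)

uncolumn : Fin 8 → Fin 4 × Bool
uncolumn v = quotient {4} 2 v , does (remainder {4} 2 v ≟ suc zero)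

column-uncolumn : ∀ v → column (uncolumn v) ≡ v
column-uncolumn = toWitness {a? = all? λ v → column (uncolumn v) ≟ v} _

uncolumn-column : ∀ x → uncolumn (column x) ≡ x
uncolumn-column (b , β) = toWitness {a? = all? (uncolumn-column? β)} (checked β) b
  where
  uncolumn-column? : ∀ β b → Dec (uncolumn (column (b , β)) ≡ (b , β))
  uncolumn-column? β b = Product.≡-dec _≟_ Bool._≟_ (uncolumn (column (b , β))) (b , β)
  checked : ∀ β → True (all? (uncolumn-column? β))
  checked false = _
  checked true  = _

block : Fin 8 → Fin 4
block = quotient {4} 2

L₈₂-edge⇒block≢ : ∀ u v → L₈₂ ∋ₑ (u , v) → block u ≢ block v
L₈₂-edge⇒block≢ = toWitness
  {a? = all? λ u → all? λ v → (v ∈ₛ? lookup L₈₂ u) →-dec ¬? (block u ≟ block v)} _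

realise : Word 8 → Signs → Vec (Fin 8) 8
realise w s = Vec.map column (assemble w s)

map-uncolumn-realise : ∀ w s → Vec.map uncolumn (realise w s) ≡ assemble w s
map-uncolumn-realise w s = trans (sym (map-∘ uncolumn column _)) (trans (map-cong uncolumn-column _) (map-id _))

-- The word is recovered from the matching as the blocks of its columns, whatever the signs.
realise-injectiveˡ : ∀ {w w′ s s′} → realise w s ≡ realise w′ s′ → w ≡ w′
realise-injectiveˡ {w} {w′} {s} {s′} eq = begin
  w                                   ≡⟨ map-proj₁-assemble w s ⟨
  Vec.map proj₁ (assemble w s)        ≡⟨ cong (Vec.map proj₁) (trans (sym (map-uncolumn-realise w s))
                                           (trans (cong (Vec.map uncolumn) eq) (map-uncolumn-realise w′ s′))) ⟩
  Vec.map proj₁ (assemble w′ s′)      ≡⟨ map-proj₁-assemble w′ s′ ⟩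
  w′                                  ∎
  where open ≡-Reasoning

-- A sign can be read off from `realise w s` only when its letter occurs in `w`.
Full : Word 8 → Set
Full w = ∀ b → ∃ λ u → lookup w u ≡ b

realise-injectiveʳ : ∀ {w s s′} → Full w → realise w s ≡ realise w s′ → s ≡ s′
realise-injectiveʳ {w} {s} {s′} full eq = lookup-extensional λ b →
  subst (λ b → lookup s b ≡ lookup s′ b) (proj₂ (full b)) (assemble-injective w assemble≡ (proj₁ (full b)))
  where
  assemble≡ : assemble w s ≡ assemble w s′
  assemble≡ = trans (sym (map-uncolumn-realise w s)) (trans (cong (Vec.map uncolumn) eq) (map-uncolumn-realise w s′))

-- Eight rows share four letters, so the bound 2 means that every letter occurs exactly twice.
IsAdmissible : Word 8 → Set
IsAdmissible w = (∀ u → block u ≢ lookup w u) × (∀ b → occurrences b w ≤ 2)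

-- The word consists of the blocks of the columns. Edges avoid the block of their row, and distinct
-- columns use each block at most twice.
IsMatchingVec⇒realise : ∀ {p} → IsMatchingVec L₈₂ p →
  ∃ λ w → ∃ λ s → IsAdmissible w × p ≡ realise w s
IsMatchingVec⇒realise {p} (edges , unique) =
  w , proj₁ signs , (avoids , λ b → occurrences≤2 x x-unique) , (begin
  p                                    ≡⟨ map-id p ⟨
  Vec.map id p                         ≡⟨ map-cong column-uncolumn p ⟨
  Vec.map (column ∘ uncolumn) p        ≡⟨ map-∘ column uncolumn p ⟩
  Vec.map column x                     ≡⟨ cong (Vec.map column) (proj₂ signs) ⟨
  realise w (proj₁ signs)              ∎)
  where
  open ≡-Reasoning
  x = Vec.map uncolumn p
  w = Vec.map proj₁ x
  x-unique : VecUnique.Unique x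
  x-unique = VecUnique.map⁺ (λ {u} {v} eq →
    trans (sym (column-uncolumn u)) (trans (cong column eq) (column-uncolumn v))) unique
  signs = assemble-surjective x x-unique
  avoids : ∀ u → block u ≢ lookup w u
  avoids u eq = L₈₂-edge⇒block≢ u (lookup p u) (edges u)
    (trans eq (trans (lookup-map u proj₁ x) (cong proj₁ (lookup-map u uncolumn p))))

-- For decimal digits below 4; reducing them mod 4 only turns them into elements of Fin 4.
digits : ∀ n → ℕ → Word n
digits n = Vec.reverse ∘ go n
  where
  go : ∀ n → ℕ → Word n
  go zero    k = []
  go (suc n) k = (k % 10) mod 4 ∷ go n (k / 10)

-- Found by computer search, as an exact cover of the 297 admissible words.
triples : List (List (Word 8))
triples = map (map (digits 8))
  ( (11003322 ∷ 23320110 ∷ 32231001 ∷ [])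
  ∷ (11023302 ∷ 22331010 ∷ 33200121 ∷ [])
  ∷ (11023320 ∷ 23230101 ∷ 32301012 ∷ [])
  ∷ (11030322 ∷ 23321001 ∷ 32203110 ∷ [])
  ∷ (11033022 ∷ 23320101 ∷ 32201310 ∷ [])
  ∷ (11203302 ∷ 23320011 ∷ 32031120 ∷ [])
  ∷ (11203320 ∷ 23031102 ∷ 32320011 ∷ [])
  ∷ (11223300 ∷ 23301012 ∷ 32030121 ∷ [])
  ∷ (11230302 ∷ 23321010 ∷ 32003121 ∷ [])
  ∷ (11230320 ∷ 22303101 ∷ 33021012 ∷ [])
  ∷ (11233002 ∷ 23021310 ∷ 32300121 ∷ [])
  ∷ (11233020 ∷ 23001312 ∷ 32320101 ∷ [])
  ∷ (11300322 ∷ 23231100 ∷ 32023011 ∷ [])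
  ∷ (11303022 ∷ 22031310 ∷ 33220101 ∷ [])
  ∷ (11320302 ∷ 23203110 ∷ 32031021 ∷ [])
  ∷ (11320320 ∷ 23031012 ∷ 32203101 ∷ [])
  ∷ (11323002 ∷ 23031120 ∷ 32200311 ∷ [])
  ∷ (11323020 ∷ 22031301 ∷ 33200112 ∷ [])
  ∷ (11330022 ∷ 23023110 ∷ 32201301 ∷ [])
  ∷ (12003312 ∷ 23231001 ∷ 31320120 ∷ [])
  ∷ (12003321 ∷ 23230110 ∷ 31321002 ∷ [])
  ∷ (12023301 ∷ 21330120 ∷ 33201012 ∷ [])
  ∷ (12023310 ∷ 21330102 ∷ 33201021 ∷ [])
  ∷ (12030312 ∷ 23203101 ∷ 31321020 ∷ [])
  ∷ (12030321 ∷ 21303102 ∷ 33221010 ∷ [])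
  ∷ (12031302 ∷ 23300121 ∷ 31223010 ∷ [])
  ∷ (12031320 ∷ 23300112 ∷ 31223001 ∷ [])
  ∷ (12033012 ∷ 23321100 ∷ 31200321 ∷ [])
  ∷ (12033021 ∷ 21300312 ∷ 33221100 ∷ [])
  ∷ (12033102 ∷ 23201310 ∷ 31320021 ∷ [])
  ∷ (12033120 ∷ 23201301 ∷ 31320012 ∷ [])
  ∷ (12203301 ∷ 21330012 ∷ 33021120 ∷ [])
  ∷ (12203310 ∷ 21331002 ∷ 33020121 ∷ [])
  ∷ (12230301 ∷ 23301120 ∷ 31023012 ∷ [])
  ∷ (12230310 ∷ 23301102 ∷ 31023021 ∷ [])
  ∷ (12231300 ∷ 23023011 ∷ 31300122 ∷ [])
  ∷ (12233001 ∷ 21301320 ∷ 33020112 ∷ [])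
  ∷ (12233010 ∷ 23001321 ∷ 31320102 ∷ [])
  ∷ (12233100 ∷ 23301021 ∷ 31020312 ∷ [])
  ∷ (12300312 ∷ 21233100 ∷ 33021021 ∷ [])
  ∷ (12300321 ∷ 21233010 ∷ 33021102 ∷ [])
  ∷ (12301302 ∷ 21033120 ∷ 33220011 ∷ [])
  ∷ (12301320 ∷ 23023101 ∷ 31230012 ∷ [])
  ∷ (12303012 ∷ 23030121 ∷ 31221300 ∷ [])
  ∷ (12303021 ∷ 21031302 ∷ 33220110 ∷ [])
  ∷ (12303102 ∷ 23020311 ∷ 31231020 ∷ [])
  ∷ (12303120 ∷ 23230011 ∷ 31021302 ∷ [])
  ∷ (12320301 ∷ 23231010 ∷ 31003122 ∷ [])
  ∷ (12320310 ∷ 23031021 ∷ 31203102 ∷ [])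
  ∷ (12321300 ∷ 23030112 ∷ 31203021 ∷ [])
  ∷ (12323001 ∷ 21030312 ∷ 33201120 ∷ [])
  ∷ (12323010 ∷ 21230301 ∷ 33001122 ∷ [])
  ∷ (12323100 ∷ 23200311 ∷ 31031022 ∷ [])
  ∷ (12330012 ∷ 23021301 ∷ 31203120 ∷ [])
  ∷ (12330021 ∷ 21023310 ∷ 33201102 ∷ [])
  ∷ (12330102 ∷ 23203011 ∷ 31021320 ∷ [])
  ∷ (12330120 ∷ 21003312 ∷ 33221001 ∷ [])
  ∷ (12331002 ∷ 23003121 ∷ 31220310 ∷ [])
  ∷ (12331020 ∷ 23003112 ∷ 31220301 ∷ [])
  ∷ (13001322 ∷ 21323010 ∷ 32230101 ∷ [])
  ∷ (13003122 ∷ 21321300 ∷ 32230011 ∷ [])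
  ∷ (13020312 ∷ 21233001 ∷ 32301120 ∷ [])
  ∷ (13020321 ∷ 22303110 ∷ 31231002 ∷ [])
  ∷ (13021302 ∷ 22303011 ∷ 31230120 ∷ [])
  ∷ (13021320 ∷ 22330101 ∷ 31203012 ∷ [])
  ∷ (13023012 ∷ 21300321 ∷ 32231100 ∷ [])
  ∷ (13023021 ∷ 21230310 ∷ 32301102 ∷ [])
  ∷ (13023102 ∷ 22301310 ∷ 31230021 ∷ [])
  ∷ (13023120 ∷ 22331001 ∷ 31200312 ∷ [])
  ∷ (13030122 ∷ 21203310 ∷ 32321001 ∷ [])
  ∷ (13031022 ∷ 21203301 ∷ 32320110 ∷ [])
  ∷ (13200312 ∷ 21331020 ∷ 32023101 ∷ [])
  ∷ (13200321 ∷ 21033012 ∷ 32321100 ∷ [])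
  ∷ (13201302 ∷ 22330011 ∷ 31023120 ∷ [])
  ∷ (13201320 ∷ 21323001 ∷ 32030112 ∷ [])
  ∷ (13203012 ∷ 22331100 ∷ 31020321 ∷ [])
  ∷ (13203021 ∷ 21320310 ∷ 32031102 ∷ [])
  ∷ (13203102 ∷ 21030321 ∷ 32321010 ∷ [])
  ∷ (13203120 ∷ 21320301 ∷ 32031012 ∷ [])
  ∷ (13220301 ∷ 22033110 ∷ 31301022 ∷ [])
  ∷ (13220310 ∷ 21033102 ∷ 32301021 ∷ [])
  ∷ (13221300 ∷ 21033021 ∷ 32300112 ∷ [])
  ∷ (13223001 ∷ 22330110 ∷ 31001322 ∷ [])
  ∷ (13223010 ∷ 22301301 ∷ 31030122 ∷ [])
  ∷ (13223100 ∷ 21330021 ∷ 32001312 ∷ [])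
  ∷ (13230012 ∷ 21323100 ∷ 32001321 ∷ [])
  ∷ (13230021 ∷ 21301302 ∷ 32023110 ∷ [])
  ∷ (13230102 ∷ 21303021 ∷ 32021310 ∷ [])
  ∷ (13230120 ∷ 21303012 ∷ 32021301 ∷ [])
  ∷ (13231002 ∷ 21303120 ∷ 32020311 ∷ [])
  ∷ (13231020 ∷ 22300311 ∷ 31023102 ∷ [])
  ∷ (13300122 ∷ 21023301 ∷ 32231010 ∷ [])
  ∷ (13301022 ∷ 22030311 ∷ 31223100 ∷ [])
  ∷ (13320012 ∷ 22033101 ∷ 31201320 ∷ [])
  ∷ (13320021 ∷ 21231300 ∷ 32003112 ∷ [])
  ∷ (13320102 ∷ 21031320 ∷ 32203011 ∷ [])
  ∷ (13320120 ∷ 22033011 ∷ 31201302 ∷ [])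
  ∷ (13321002 ∷ 21003321 ∷ 32230110 ∷ [])
  ∷ (13321020 ∷ 22003311 ∷ 31230102 ∷ [])
  ∷ [] )

-- Verification of the table as an exact cover

words : Vec (List A) n → List (Vec A n)
words []         = [] ∷ []
words (xs ∷ xss) = cartesianProductWith _∷_ xs (words xss)

∈-words : ∀ (xss : Vec (List A) n) {w} → (∀ u → lookup w u ∈ lookup xss u) → w ∈ words xss
∈-words []         {[]}    _  = here refl
∈-words (xs ∷ xss) {_ ∷ _} w∈ = ∈-cartesianProductWith⁺ _∷_ (w∈ zero) (∈-words xss (w∈ ∘ suc))

otherBlocks : Fin 8 → List (Fin 4)
otherBlocks u = filter (λ b → ¬? (block u ≟ b)) (allFin 4)

_≟ʷ_ : (w w′ : Word 8) → Dec (w ≡ w′)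
_≟ʷ_ = ≡-dec _≟_

open import Data.List.Membership.DecPropositional _≟ʷ_ using () renaming (_∈?_ to _∈ʷ?_)

-- As an argument of a function, the table is evaluated only once.
coversBalanced? : ∀ ts → Dec (All (λ w → (∀ b → occurrences b w ≤ 2) → Any (w ∈_) ts)
                                  (words (tabulate otherBlocks)))
coversBalanced? ts = All.all?
  (λ w → all? (λ b → occurrences b w ℕ.≤? 2) →-dec Any.any? (w ∈ʷ?_) ts)
  (words (tabulate otherBlocks))

-- Evaluation runs through the 3⁸ words that avoid the block of each row and looks up the balanced
-- ones in the table.
triples-complete : ∀ w → IsAdmissible w → Any (w ∈_) triples
triples-complete w (avoids , balanced) = All.lookup (toWitness {a? = coversBalanced? triples} _)
  (∈-words (tabulate otherBlocks) λ u → subst (lookup w u ∈_) (sym (lookup∘tabulate otherBlocks u))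
    (∈-filter⁺ (λ b → ¬? (block u ≟ b)) (∈-allFin (lookup w u)) (avoids u)))
  balanced

triples-disjoint : AllPairs (λ t t′ → All (_∉ t′) t) triples
triples-disjoint = toWitness
  {a? = AllPairs.allPairs? (λ t t′ → All.all? (λ w → ¬? (w ∈ʷ? t′)) t) triples} _

triples-full : All (All Full) triples
triples-full = toWitness
  {a? = All.all? (All.all? λ w → all? λ b → any? λ u → lookup w u ≟ b) triples} _

-- Sign classes and the parts of the partition

booleans : List Bool
booleans = false ∷ true ∷ []

∈-booleans : ∀ β → β ∈ booleans
∈-booleans false = here refl
∈-booleans true  = there (here refl)

bits : ∀ n → List (Vec Bool n)
bits n = words (Vec.replicate n booleans)

∈-bits : ∀ (c : Vec Bool n) → c ∈ bits n
∈-bits c = ∈-words (Vec.replicate _ booleans) λ u →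
  subst (lookup c u ∈_) (sym (lookup-replicate u booleans)) (∈-booleans (lookup c u))

bits-unique : Unique (bits 3)
bits-unique = toWitness
  {a? = AllPairs.allPairs? (λ c c′ → ¬? (≡-dec Bool._≟_ c c′)) (bits 3)} _

-- Sign vectors modulo complementing all signs: `c` names the representative whose first sign is
-- `false`, and `β` tells whether it is complemented.
signs : Bool → Vec Bool 3 → Signs
signs β c = Vec.map (β xor_) (false ∷ c)

signs-surjective : ∀ s → ∃ λ β → ∃ λ c → s ≡ signs β c
signs-surjective (false ∷ c) = false , c , cong (false ∷_) (sym (map-id c))
signs-surjective (true ∷ c)  = true , Vec.map not c ,
  cong (true ∷_) (sym (trans (sym (map-∘ not not c)) (trans (map-cong Bool.not-involutive c) (map-id c))))

-- The first signs are `β` and `β′`, so the mixed cases are impossible.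
signs-injectiveʳ : ∀ β β′ {c c′} → signs β c ≡ signs β′ c′ → c ≡ c′
signs-injectiveʳ false false eq = map-injective id (proj₂ (∷-injective eq))
signs-injectiveʳ true  true  eq = map-injective Bool.not-injective (proj₂ (∷-injective eq))

-- Complementing all signs exchanges the two columns of every block, so the two
-- realisations of a word together cover both columns of the block in each row.
part : List (Word 8) → Vec Bool 3 → List (Vec (Fin 8) 8)
part t c = cartesianProductWith (λ w β → realise w (signs β c)) t booleans

∈-part⁻ : ∀ t {c p} → p ∈ part t c → ∃ λ w → ∃ λ β → w ∈ t × p ≡ realise w (signs β c)
∈-part⁻ t {c} p∈ with ∈-cartesianProductWith⁻ (λ w β → realise w (signs β c)) t booleans p∈
... | w , β , w∈t , _ , p≡ = w , β , w∈t , p≡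

-- The lists stay arbitrary, so that the lemmas below rest only on the cover properties of `ts` and
-- on `cs` listing each vector once.
partsOf : List (List (Word 8)) → List (Vec Bool 3) → List (List (Vec (Fin 8) 8))
partsOf ts cs = concatMap (λ t → map (part t) cs) ts

Disjoint : List A → List A → Set
Disjoint X Y = ∀ a → ¬ (a ∈ X × a ∈ Y)

-- A common matching determines its word, which rules out different triples. Within one triple,
-- fullness of the word recovers the signs and hence `c`.
partsOf-disjoint : ∀ {ts cs} → All (All Full) ts → AllPairs (λ t t′ → All (_∉ t′) t) ts → Unique cs →
  AllPairs Disjoint (partsOf ts cs)
partsOf-disjoint {ts} {cs} full disjoint unique = AllPairs.concat⁺
  (All.map⁺ (All.map (λ {t} full → AllPairs.map⁺ (AllPairs.map (sameTriple t full) unique)) full))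
  (AllPairs.map⁺ (AllPairs.map (λ {t} {t′} t#t′ → All.map⁺ (All.universal (λ c →
    All.map⁺ (All.universal (λ c′ → otherTriple t t′ c c′ t#t′) cs)) cs)) disjoint))
  where
  sameTriple : ∀ t {c c′} → All Full t → c ≢ c′ → Disjoint (part t c) (part t c′)
  sameTriple t full c≢c′ p (p∈ , p∈′) with ∈-part⁻ t p∈ | ∈-part⁻ t p∈′
  ... | w , β , w∈t , refl | w′ , β′ , _ , eq with realise-injectiveˡ eq
  ... | refl = c≢c′ (signs-injectiveʳ β β′ (realise-injectiveʳ (All.lookup full w∈t) eq))
  otherTriple : ∀ t t′ c c′ → All (_∉ t′) t → Disjoint (part t c) (part t′ c′)
  otherTriple t t′ c c′ t#t′ p (p∈ , p∈′) with ∈-part⁻ t p∈ | ∈-part⁻ t′ p∈′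
  ... | w , β , w∈t , refl | w′ , β′ , w′∈t′ , eq with realise-injectiveˡ eq
  ... | refl = All.lookup t#t′ w∈t w′∈t′

-- The word of the matching selects the triple, and the class of its signs selects `c`.
partsOf-complete : ∀ {ts cs} → (∀ w → IsAdmissible w → Any (w ∈_) ts) → (∀ c → c ∈ cs) →
  ∀ {p} → IsMatchingVec L₈₂ p → Any (p ∈_) (partsOf ts cs)
partsOf-complete {ts} {cs} ts-complete cs-complete p✓ with IsMatchingVec⇒realise p✓
... | w , s , w✓ , refl with signs-surjective s
... | β , c , refl = Any.concatMap⁺ (λ t → map (part t) cs) (Any.map (λ {t} w∈t → Any.map⁺ {f = part t}
  (lose (cs-complete c) (∈-cartesianProductWith⁺ (λ w β → realise w (signs β c)) w∈t (∈-booleans β))))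
  (ts-complete w w✓))

parts : List (List (Vec (Fin 8) 8))
parts = partsOf triples (bits 3)

isMatchingVec? : ∀ (G : EdgeSet n) p → Dec (IsMatchingVec G p)
isMatchingVec? G p = map′ (λ (e , u) → e , u) (λ (e , u) → e , u)
  (all? (λ u → lookup p u ∈ₛ? lookup G u) ×-dec VecAllPairs.allPairs? (λ x y → ¬? (x ≟ y)) p)

isFactorizationVec? : ∀ (G : EdgeSet n) ps → Dec (IsFactorizationVec G ps)
isFactorizationVec? G ps = all? λ u →
  AllPairs.allPairs? (λ v v′ → ¬? (v ≟ v′)) (at u ps) ×-dec
  all? (λ v → (v ∈ₛ? lookup G u) →-dec Any.any? (v ≟_) (at u ps))

allFactorizations? : ∀ (G : EdgeSet n) pss →
  Dec (All (λ ps → All (IsMatchingVec G) ps × IsFactorizationVec G ps) pss)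
allFactorizations? G = All.all? λ ps → All.all? (isMatchingVec? G) ps ×-dec isFactorizationVec? G ps

-- Evaluated on all 99 · 8 parts of six matchings; the row condition on the triples is checked here.
parts-factorizations : All (λ ps → All (IsMatchingVec L₈₂) ps × IsFactorizationVec L₈₂ ps) parts
parts-factorizations = toWitness {a? = allFactorizations? L₈₂ parts} _

partsOf-isListPartition : ∀ ts cs → All (All Full) ts → AllPairs (λ t t′ → All (_∉ t′) t) ts →
  (∀ w → IsAdmissible w → Any (w ∈_) ts) → Unique cs → (∀ c → c ∈ cs) →
  All (λ ps → All (IsMatchingVec L₈₂) ps × IsFactorizationVec L₈₂ ps) (partsOf ts cs) →
  IsListPartition (IsMatchingVec L₈₂) (partsOf ts cs)
partsOf-isListPartition ts cs full disjoint ts-complete unique cs-complete factorizations = record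
  { unique      = All.map (IsFactorizationVec⇒Unique {G = L₈₂} ∘ proj₂) factorizations
  ; isPartition = record
    { nonempty = All.map (nonempty ∘ proj₂) factorizations
    ; disjoint = partsOf-disjoint {ts} {cs} full disjoint unique
    ; union    = λ p → mk⇔ (partsOf-complete {ts} {cs} ts-complete cs-complete) λ p∈ →
        let _ , X∈ , p∈X = find p∈ in All.lookup (proj₁ (All.lookup factorizations X∈)) p∈X
    }
  }
  where
  nonempty : ∀ {ps} → IsFactorizationVec L₈₂ ps → ∃ λ p → p ∈ ps
  nonempty F =
    -- Column 2 is the first one outside the block of row 0, so some matching of the part must use
    -- this edge.
    let p , p∈ , _ = ∈-map⁻ _ (proj₂ (F zero) (suc (suc zero)) (lookup⇒[]= _ _ refl)) in p , p∈

-- Row sums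

rowSum : Fin n → Matrix n → ℕ
rowSum i M = Vec.sum (lookup M i)

sum-zipWith-+ : ∀ (xs ys : Vec ℕ n) → Vec.sum (Vec.zipWith _+_ xs ys) ≡ Vec.sum xs + Vec.sum ys
sum-zipWith-+ []       []       = refl
sum-zipWith-+ (x ∷ xs) (y ∷ ys) rewrite sum-zipWith-+ xs ys =
  interchange x y (Vec.sum xs) (Vec.sum ys)

rowSum-+ₘ : ∀ (i : Fin n) M N → rowSum i (M +ₘ N) ≡ rowSum i M + rowSum i N
rowSum-+ₘ i M N rewrite lookup-zipWith (Vec.zipWith _+_) i M N =
  sum-zipWith-+ (lookup M i) (lookup N i)

sum-indicator : ∀ (k : Fin n) → Vec.sum (tabulate λ j → if does (k ≟ j) then 1 else 0) ≡ 1
sum-indicator {suc n} zero    = cong suc (sum-zeros n)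
  where
  sum-zeros : ∀ n → Vec.sum (tabulate {n = n} λ _ → 0) ≡ 0
  sum-zeros zero    = refl
  sum-zeros (suc n) = sum-zeros n
sum-indicator (suc k) = sum-indicator k

rowSum-permutationMatrix : ∀ (i : Fin n) {P} → IsPermutationMatrix P → rowSum i P ≡ 1
rowSum-permutationMatrix i (σ , refl) =
  trans (cong Vec.sum (lookup∘tabulate _ i)) (sum-indicator (σ ⟨$⟩ʳ i))

rowSum-0ₘ : ∀ (i : Fin n) → rowSum i (constMatrix 0) ≡ 0
rowSum-0ₘ {n} i rewrite lookup-replicate i (Vec.replicate n 0) = sum-zeros n
  where
  sum-zeros : ∀ n → Vec.sum (Vec.replicate n 0) ≡ 0
  sum-zeros zero    = refl
  sum-zeros (suc n) = sum-zeros n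

-- Each permutation matrix adds 1 to every row sum, so a row sum counts the matrices.
rowSum-sumₘ : ∀ (i : Fin n) {Ps} → All IsPermutationMatrix Ps → rowSum i (sumₘ Ps) ≡ length Ps
rowSum-sumₘ i []        = rowSum-0ₘ i
rowSum-sumₘ i (_∷_ {P} {Ps} P✓ Ps✓) =
  trans (rowSum-+ₘ i P (sumₘ Ps)) (cong₂ _+_ (rowSum-permutationMatrix i P✓) (rowSum-sumₘ i Ps✓))

-- Transfer from vectors to graphs and matrices

module _ {n} {G : EdgeSet (suc n)} {pss : List (List (Vec (Fin (suc n)) (suc n)))}
  (partition : IsListPartition (IsMatchingVec G) pss)
  (factorizations : All (λ ps → All (IsMatchingVec G) ps × IsFactorizationVec G ps) pss) where

  hasPerfectPartition : ∃ (λ d → IsRegular d G) → HasPerfectPartition G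
  hasPerfectPartition regular = record
    { regular        = regular
    ; parts          = map (map toEdges) pss
    ; isPartition    = IsListPartition-map toEdges toEdges-injective (IsPerfectMatching⇔ G) partition
    ; factorizations = All.map⁺
        (All.map (λ (ps✓ , F) → IsFactorizationVec⇒IsOneFactorization ps✓ F) factorizations)
    }

  hasMatrixPerfectPartition : HasMatrixPerfectPartition (biadjacency G)
  hasMatrixPerfectPartition = record
    { parts       = map (map toMatrix) pss
    ; isPartition = IsListPartition-map toMatrix toMatrix-injective (IsPermutationMatrixBelow⇔ G) partition
    ; sums        = All.map⁺ (All.map (λ (ps✓ , F) → IsFactorizationVec⇒sum ps✓ F) factorizations)
    }

L₈₂-regular : IsRegular 6 L₈₂
L₈₂-regular =
  toWitness {a? = all? λ u → leftDegree L₈₂ u ℕ.≟ 6} _ ,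
  toWitness {a? = all? λ v → rightDegree L₈₂ v ℕ.≟ 6} _

parts-isListPartition : IsListPartition (IsMatchingVec L₈₂) parts
parts-isListPartition = partsOf-isListPartition triples (bits 3)
  triples-full triples-disjoint triples-complete bits-unique ∈-bits parts-factorizations

theorem3p1 : HasPerfectPartition L₈₂
    × HasMatrixPerfectPartition (biadjacency L₈₂)
    × ((Ps : List (Matrix 8)) → Unique Ps → All (IsPermutationMatrixBelow (biadjacency L₈₂)) Ps → sumₘ Ps ≡ biadjacency L₈₂ → length Ps ≡ 6)
theorem3p1 =
  hasPerfectPartition {pss = parts} parts-isListPartition parts-factorizations (6 , L₈₂-regular) ,
  hasMatrixPerfectPartition {pss = parts} parts-isListPartition parts-factorizations ,
  -- Row 0 of `biadjacency L₈₂` evaluates to the sum 6.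
  λ Ps _ Ps✓ sum≡ → trans (sym (rowSum-sumₘ zero (All.map proj₁ Ps✓))) (cong (rowSum zero) sum≡)
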